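{- Let $C=C(\{C_s\}_{s\in S})\subseteq\Sigma^n$ be a lifted code such that all the codes $C_s$ have the same cardinality, and let $L\subseteq\prod_{s\in S}C_s$ be its line code. Let $G$ be a graph with a labelling $\ell:G\to P([n])$ of its vertices and edges such that $\ell$ restricts to a bijection from the vertex set of $G$ onto $S$ and $\ell(v)\supseteq\ell(e)$ for every edge $e$ and vertex $v$ of $e$. Suppose that every vertex of $G$ belongs to at least $d_{\min}\geq 1$ and at most $d_{\max}$ edges. If the tester $T_{G,\ell}$ for $L$ has soundness $\mu$ ($\mu\ge0$), then the natural tester of $C$ has soundness $$\frac{k_{\min}D_{\min}}{k_{\max}D_{\max}}\cdot\frac{\mu}{\mu+2d_{\max}d_{\min}^{ -1}}.$$
   Context: $\Sigma$ is a finite alphabet, $[n]=\{1,\dots,n\}$, $P([n])$ its power set; $\mathrm{dist}$ denotes normalized Hamming distance (also on $\prod_{s\in S}C_s$, counting coordinates $s$). Graphs are finite, may have multiple edges, no loops. **Lifted code.** $S$ is a collection of nonempty subsets of $[n]$ with $\bigcup_{s\in S}s=[n]$ and $C_s\subseteq\Sigma^s$ is a nonempty code for each $s\in S$; $C(\{C_s\}_{s\in S})=\{g\in\Sigma^n:g|_s\in C_s\ \forall s\in S\}$, assumed nonempty. Its natural tester: given $g\in\Sigma^n$, choose $s\in S$ uniformly at random and accept iff $g|_s\in C_s$. **Line code.** $L=\{(f_s)_{s\in S}\in\prod_{s\in S}C_s:f_s|_{s\cap s'}=f_{s'}|_{s\cap s'}\ \forall s,s'\in S\}$; identifying each $C_s$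 with a fixed set $\Sigma'$, $L$ is a code inside $\Sigma'^S$. **Tester $T_{G,\ell}$ for $L$.** Given $f=(f_s)_{s\in S}\in\prod_sC_s$, choose an edge $e$ of $G$ uniformly at random, with endpoints $u,v$, and accept iff $f_{\ell(u)}|_{\ell(e)}=f_{\ell(v)}|_{\ell(e)}$. **Soundness.** A tester for a code $D$ has soundness $\mu$ if $\mathrm{Prob}(\text{reject }f)\ge\mu\,\mathrm{dist}(f,D)$ for every word $f$. **Constants.** $k_{\min}=\min_{s\in S}|s|$, $k_{\max}=\max_{s\in S}|s|$, $D_{\min}=\min_{i\in[n]}\#\{s\in S:i\in s\}$, $D_{\max}=\max_{i\in[n]}\#\{s\in S:i\in s\}$. -}

module Defs where

open import Algebra.Bundles using (CommutativeRing)
open import Algebra.Definitions.RawMonoid using () renaming (_×_ to multiple)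
open import Data.Bool.Base using (Bool; T)
open import Data.Bool.Properties using (T?; T-irrelevant)
open import Data.Fin.Base using (Fin)
open import Data.Fin.Properties using () renaming (_≟_ to _≟ᶠ_)
open import Data.Fin.Subset
  using (Subset; inside; outside; _∈_; _⊆_; _∩_; ∣_∣; Nonempty)
open import Data.Fin.Subset.Properties using (_∈?_; p∩q⊆p; p∩q⊆q)
open import Data.Nat.Base as ℕ using (ℕ; zero; suc; _⊓_; _⊔_)
open import Data.Product.Base using (∃; _×_; _,_; proj₁)
open import Data.Product.Properties using (≡-dec)
open import Data.Sum.Base using (_⊎_; inj₁; inj₂)
open import Data.Vec.Base using ([]; _∷_; here; there; tabulate; allFin; count; foldr₁)
open import Data.Vec.Functional using (foldr)
open import Function.Bundles using (_⤖_)
open import Function.Definitions using (Injective; Bijective)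
open import Level using (Level; 0ℓ) renaming (suc to lsuc; _⊔_ to _⊔ˡ_)
open import Relation.Binary.Core using (Rel)
open import Relation.Binary.Definitions using (DecidableEquality)
open import Relation.Binary.PropositionalEquality using (_≡_; _≢_; refl; cong; cong₂)
open import Relation.Binary.Structures using (IsTotalOrder)
open import Relation.Nullary using (¬_; Dec; yes; no; ¬?)
open import Relation.Nullary.Decidable using (map′; _×-dec_; _⊎-dec_)
open import Relation.Unary using (Pred; Decidable)

------------------------------------------------------------------------
-- Scalars

-- The library has no real numbers; ℝ enters as one example of an ordered
-- field.  The inverse is a total operation that is unconstrained at 0#.

record OrderedField (c ℓ₁ ℓ₂ : Level) : Set (lsuc (c ⊔ˡ ℓ₁ ⊔ˡ ℓ₂)) where
  infix  4 _≤_
  infix  8 _⁻¹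
  infixl 7 _/_
  field
    commutativeRing : CommutativeRing c ℓ₁

  open CommutativeRing commutativeRing public

  field
    _≤_          : Rel Carrier ℓ₂
    isTotalOrder : IsTotalOrder _≈_ _≤_
    +-monoˡ-≤    : ∀ z {x y} → x ≤ y → x + z ≤ y + z
    *-nonNeg     : ∀ {x y} → 0# ≤ x → 0# ≤ y → 0# ≤ x * y
    0#≉1#        : ¬ (0# ≈ 1#)
    _⁻¹          : Carrier → Carrier
    *-inverseʳ   : ∀ x → ¬ (x ≈ 0#) → x * x ⁻¹ ≈ 1#

  _/_ : Carrier → Carrier → Carrier
  x / y = x * y ⁻¹

  fromℕ : ℕ → Carrier
  fromℕ k = multiple +-rawMonoid k 1#

------------------------------------------------------------------------
-- Finite counting and extrema

#_ : ∀ {k} {P : Pred (Fin k) 0ℓ} → Decidable P → ℕ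
#_ {k} P? = count P? (allFin k)

-- The minimum of the empty family is set to 0; it only occurs for the
-- degenerate block length n = 0.
minimum : ∀ {k} → (Fin k → ℕ) → ℕ
minimum {zero}  _ = 0
minimum {suc _} f = foldr₁ _⊓_ (tabulate f)

maximum : ∀ {k} → (Fin k → ℕ) → ℕ
maximum = foldr _⊔_ 0

------------------------------------------------------------------------
-- Codes, testers and soundness

-- The ambient product ∏ⱼ Letter j.  Words are functions, so a code is a
-- predicate on them, and the alphabet may depend on the coordinate, which
-- covers both Σⁿ and ∏ₛ Cₛ.

record Space : Set₁ where
  field
    size   : ℕ
    Letter : Fin size → Set
    _≟_    : ∀ {j} → DecidableEquality (Letter j)

  Words : Set
  Words = ∀ j → Letter j

  hamming : Words → Words → ℕ
  hamming f g = # (λ j → ¬? (f j ≟ g j))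

-- A tester draws one of finitely many equally likely choices.
record Tester (W : Set) : Set₁ where
  field
    choices  : ℕ
    Accepts  : Fin choices → W → Set
    accepts? : ∀ r f → Dec (Accepts r f)

  rejections : W → ℕ
  rejections f = # (λ r → ¬? (accepts? r f))

module _ {c ℓ₁ ℓ₂} (F : OrderedField c ℓ₁ ℓ₂) where
  open OrderedField F using (Carrier; _≈_; _≤_; _*_; _/_; fromℕ)

  rejectProb : ∀ {W} → Tester W → W → Carrier
  rejectProb t f = fromℕ (Tester.rejections t f) / fromℕ (Tester.choices t)

  module _ (X : Space) where
    open Space X

    dist : Words → Words → Carrier
    dist f g = fromℕ (hamming f g) / fromℕ size

    -- dist(f , D) ≈ d, the distance to a code being the minimum over D.
    IsDistanceTo : (D : Words → Set) → Words → Carrier → Set (ℓ₁ ⊔ˡ ℓ₂)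
    IsDistanceTo D f d =
      (∃ λ h → D h × d ≈ dist f h) × (∀ h → D h → d ≤ dist f h)

    HasSoundness : (D : Words → Set) → Tester Words → Carrier → Set (c ⊔ˡ ℓ₁ ⊔ˡ ℓ₂)
    HasSoundness D t μ =
      ∀ f d → IsDistanceTo D f d → μ * d ≤ rejectProb t f

------------------------------------------------------------------------
-- Words indexed by a subset

-- Word A s is Aˢ: one letter for every element of s.  Being first-order
-- data, it has propositional equality as its extensional equality.

infixr 5 _∷_

data Word (A : Set) : ∀ {n} → Subset n → Set where
  []   : Word A []
  _∷_  : ∀ {n} {s : Subset n} → A → Word A s → Word A (inside ∷ s)
  skip : ∀ {n} {s : Subset n} → Word A s → Word A (outside ∷ s)

module _ {A : Set} where

  at : ∀ {n} {s : Subset n} → Word A s → ∀ {i} → i ∈ s → A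
  at (a ∷ w)  here      = a
  at (a ∷ w)  (there p) = at w p
  at (skip w) (there p) = at w p

  build : ∀ {n} (s : Subset n) → (∀ {i} → i ∈ s → A) → Word A s
  build []            a = []
  build (inside  ∷ s) a = a here ∷ build s (λ p → a (there p))
  build (outside ∷ s) a = skip (build s (λ p → a (there p)))

  -- g |ₛ for g ∈ Aⁿ, and w |ₜ for w ∈ Aˢ and t ⊆ s.

  restrict : ∀ {n} (s : Subset n) → (Fin n → A) → Word A s
  restrict s g = build s (λ {i} _ → g i)

  shrink : ∀ {n} {s t : Subset n} → t ⊆ s → Word A s → Word A t
  shrink t⊆s w = build _ (λ p → at w (t⊆s p))

  Word-≟ : DecidableEquality A → ∀ {n} {s : Subset n} → DecidableEquality (Word A s)
  Word-≟ _≟_ []       []       = yes refl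
  Word-≟ _≟_ (a ∷ v)  (b ∷ w)  =
    map′ (λ (p , q) → cong₂ _∷_ p q) (λ { refl → refl , refl })
         ((a ≟ b) ×-dec Word-≟ _≟_ v w)
  Word-≟ _≟_ (skip v) (skip w) =
    map′ (cong skip) (λ { refl → refl }) (Word-≟ _≟_ v w)

------------------------------------------------------------------------
-- Lifted codes

-- Over the alphabet Fin q.  The collection S ⊆ P([n]) is enumerated without
-- repetition by `set`, so Fin m stands for S.  Codes are boolean-valued, as
-- library subsets are: classically these are all subsets, and it makes
-- codewords with equal underlying words equal.

record LiftedCode (q n : ℕ) : Set where
  field
    m             : ℕ
    set           : Fin m → Subset n
    set-injective : Injective _≡_ _≡_ set
    set-nonempty  : ∀ s → Nonempty (set s)
    covering      : ∀ i → ∃ λ s → i ∈ set s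
    code          : ∀ s → Word (Fin q) (set s) → Bool

  Codeword : Fin m → Set
  Codeword s = ∃ λ w → T (code s w)

  ambient : Space
  ambient = record { size = n ; Letter = λ _ → Fin q ; _≟_ = _≟ᶠ_ }

  C : (Fin n → Fin q) → Set
  C g = ∀ s → T (code s (restrict (set s) g))

  field
    code-nonempty : ∀ s → Codeword s
    C-nonempty    : ∃ C

  naturalTester : Tester (Fin n → Fin q)
  naturalTester = record
    { choices  = m
    ; Accepts  = λ s g → T (code s (restrict (set s) g))
    ; accepts? = λ s g → T? (code s (restrict (set s) g))
    }

  EqualCardinalities : Set
  EqualCardinalities = ∀ s s′ → Codeword s ⤖ Codeword s′

  lineAmbient : Space
  lineAmbient = record
    { size   = m
    ; Letter = Codeword
    ; _≟_    = ≡-dec (Word-≟ _≟ᶠ_) (λ p p′ → yes (T-irrelevant p p′))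
    }

  L : (∀ s → Codeword s) → Set
  L f = ∀ s s′ → shrink (p∩q⊆p (set s) (set s′)) (proj₁ (f s))
               ≡ shrink (p∩q⊆q (set s) (set s′)) (proj₁ (f s′))

  kMin kMax DMin DMax : ℕ
  kMin = minimum (λ s → ∣ set s ∣)
  kMax = maximum (λ s → ∣ set s ∣)
  DMin = minimum (λ i → # (λ s → i ∈? set s))
  DMax = maximum (λ i → # (λ s → i ∈? set s))

------------------------------------------------------------------------
-- Labelled graphs

-- Edges are undirected: which endpoint is called `src` is immaterial to
-- every notion below.

record Graph : Set where
  field
    nV nE   : ℕ
    src tgt : Fin nE → Fin nV
    no-loop : ∀ e → src e ≢ tgt e

  Incident : Fin nV → Fin nE → Set
  Incident v e = src e ≡ v ⊎ tgt e ≡ v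

  degree : Fin nV → ℕ
  degree v = # (λ e → (src e ≟ᶠ v) ⊎-dec (tgt e ≟ᶠ v))

-- The label of a vertex v is set (ℓᵥ v); since `set` is a bijection onto S,
-- bijectivity of ℓᵥ says that vertex labels form a bijection onto S.
record Labelling {q n} (𝒞 : LiftedCode q n) (G : Graph) : Set where
  open LiftedCode 𝒞
  open Graph G
  field
    ℓᵥ           : Fin nV → Fin m
    ℓᵥ-bijective : Bijective _≡_ _≡_ ℓᵥ
    ℓₑ           : Fin nE → Subset n
    ℓₑ⊆ℓᵥ        : ∀ {v e} → Incident v e → ℓₑ e ⊆ set (ℓᵥ v)

  srcView tgtView : (∀ s → Codeword s) → ∀ e → Word (Fin q) (ℓₑ e)
  srcView f e = shrink (ℓₑ⊆ℓᵥ (inj₁ refl)) (proj₁ (f (ℓᵥ (src e))))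
  tgtView f e = shrink (ℓₑ⊆ℓᵥ (inj₂ refl)) (proj₁ (f (ℓᵥ (tgt e))))

  edgeTester : Tester (∀ s → Codeword s)
  edgeTester = record
    { choices  = nE
    ; Accepts  = λ e f → srcView f e ≡ tgtView f e
    ; accepts? = λ e f → Word-≟ _≟ᶠ_ (srcView f e) (tgtView f e)
    }

{-# OPTIONS --safe #-}
-- Decode a word g to f ∈ ∏ Cₛ, with fₛ = g|ₛ wherever the natural tester
-- accepts.  Every edge rejecting f has a rejected endpoint, so f is rejected
-- with probability at most K α, where α = Prob(reject g) and
-- K = 2 dmax / dmin; hence f is at distance δ from L with μ δ ≤ K α.  The
-- nearest element of L is the line word of some h ∈ C, and g|ₛ ≠ h|ₛ on at
-- most a fraction α + δ of S.  Double counting the incidences i ∈ s turns this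
-- into dist(g , h) ≤ (kMax DMax / kMin DMin) (α + δ), while
-- μ (α + δ) ≤ (μ + K) α.

module Submission where

open import Defs
import Algebra.Properties.AbelianGroup
import Algebra.Properties.Monoid.Mult
import Algebra.Properties.Ring
import Algebra.Properties.Semiring.Mult
import Algebra.Properties.Semiring.Sum
import Algebra.Solver.Ring.NaturalCoefficients.Default
open import Data.Bool.Base using (if_then_else_; true; false; T)
open import Data.Bool.Properties using (T-irrelevant)
open import Data.Fin.Base using (Fin; zero; suc; fromℕ<; finToFun; funToFin)
open import Data.Fin.Properties using (all?; finToFun-funToFin; suc-injective)
  renaming (_≟_ to _≟ᶠ_)
open import Data.Fin.Subset using (Subset; inside; outside; _∈_; _⊆_; ∣_∣)
open import Data.Fin.Subset.Properties using (_∈?_; p∩q⊆p; p∩q⊆q; x∈p∩q⁺)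
open import Data.List.Base using (List; map; filter; allFin)
open import Data.List.Extrema.Nat using (argmin; argmin-all; f[argmin]≤f[xs])
open import Data.List.Membership.Propositional.Properties using (∈-map⁺; ∈-filter⁺; ∈-allFin)
import Data.List.Relation.Unary.All as All
open import Data.List.Relation.Unary.All.Properties using (all-filter)
open import Data.Nat.Base as ℕ using (ℕ; zero; suc; z≤n; s≤s)
import Data.Nat.Properties as ℕₚ
open import Data.Product.Base using (∃; _×_; _,_; proj₁; proj₂)
open import Data.Sum.Base using (_⊎_; inj₁; inj₂)
open import Data.Vec.Base using ([]; _∷_; here; there; count; tabulate)
open import Data.Vec.Properties using (count≤n)
open import Data.Vec.Functional using (Vector)
open import Function.Base using (_∘_; id; case_of_)
open import Function.Definitions using (Injective)
open import Level using (0ℓ)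
open import Relation.Binary.Bundles using (Poset)
import Relation.Binary.Reasoning.PartialOrder
import Relation.Binary.Structures
open import Relation.Binary.PropositionalEquality
  using (_≡_; _≢_; _≗_; refl; sym; trans; cong; cong₂; subst; module ≡-Reasoning)
open import Relation.Nullary using (¬_; Dec; does; yes; no; ¬?; contradiction)
open import Relation.Nullary.Decidable using (_×-dec_; _⊎-dec_)
open import Relation.Unary using (Pred; Decidable; U)
open import Relation.Unary.Properties using (U?)

open Algebra.Properties.Semiring.Sum ℕₚ.+-*-semiring
  using (sum; ∑-comm; ∑-distrib-+; *-distribʳ-sum)

-- Counting

indicator : ∀ {A : Set} → Dec A → ℕ
indicator A? = if does A? then 1 else 0

indicator-mono : ∀ {A B : Set} (A? : Dec A) (B? : Dec B) → (A → B) →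
                 indicator A? ℕ.≤ indicator B?
indicator-mono (no _)  _       _   = z≤n
indicator-mono (yes a) (yes _) _   = ℕₚ.≤-refl
indicator-mono (yes a) (no ¬b) a→b = contradiction (a→b a) ¬b

indicator-⊎ : ∀ {A B C : Set} (A? : Dec A) (B? : Dec B) (C? : Dec C) → (A → B ⊎ C) →
              indicator A? ℕ.≤ indicator B? ℕ.+ indicator C?
indicator-⊎ (no _)  _       _       _ = z≤n
indicator-⊎ (yes a) (yes _) _       _ = s≤s z≤n
indicator-⊎ (yes a) (no _)  (yes _) _ = s≤s z≤n
indicator-⊎ (yes a) (no ¬b) (no ¬c) f with f a
... | inj₁ b = contradiction b ¬b
... | inj₂ c = contradiction c ¬c

sum-mono-≤ : ∀ {k} {f g : Vector ℕ k} → (∀ i → f i ℕ.≤ g i) → sum f ℕ.≤ sum g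
sum-mono-≤ {zero}  f≤g = z≤n
sum-mono-≤ {suc k} f≤g = ℕₚ.+-mono-≤ (f≤g zero) (sum-mono-≤ (f≤g ∘ suc))

sum-upper : ∀ {k} (f : Vector ℕ k) i → f i ℕ.≤ sum f
sum-upper f zero    = ℕₚ.m≤m+n _ _
sum-upper f (suc i) = ℕₚ.m≤n⇒m≤o+n (f zero) (sum-upper (f ∘ suc) i)

-- The induction passes from `f` to `f ∘ suc`, so it needs an arbitrary `f`; `allFin` is the case
-- `f = id`. As sums of 0/1 values, counts can be added and exchanged.
count-tabulate : ∀ {A : Set} {P : Pred A 0ℓ} (P? : Decidable P) {k} (f : Fin k → A) →
                 count P? (tabulate f) ≡ sum (indicator ∘ P? ∘ f)
count-tabulate P? {zero}  f = refl
count-tabulate P? {suc k} f with does (P? (f zero))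
... | true  = cong suc (count-tabulate P? (f ∘ suc))
... | false = count-tabulate P? (f ∘ suc)

module _ {k} {P : Pred (Fin k) 0ℓ} (P? : Decidable P) where

  #≡sum : # P? ≡ sum (indicator ∘ P?)
  #≡sum = count-tabulate P? id

  #-positive : ∀ {i} → P i → 1 ℕ.≤ # P?
  #-positive {i} p = begin
    1                      ≤⟨ indicator-mono (yes p) (P? i) id ⟩
    indicator (P? i)       ≤⟨ sum-upper (indicator ∘ P?) i ⟩
    sum (indicator ∘ P?)   ≡⟨ #≡sum ⟨
    # P?                   ∎
    where open ℕₚ.≤-Reasoning

  module _ {Q : Pred (Fin k) 0ℓ} (Q? : Decidable Q) where

    #-mono : (∀ i → P i → Q i) → # P? ℕ.≤ # Q?
    #-mono P⊆Q = begin
      # P?                  ≡⟨ #≡sum ⟩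
      sum (indicator ∘ P?)  ≤⟨ sum-mono-≤ (λ i → indicator-mono (P? i) (Q? i) (P⊆Q i)) ⟩
      sum (indicator ∘ Q?)  ≡⟨ count-tabulate Q? id ⟨
      # Q?                  ∎
      where open ℕₚ.≤-Reasoning

    #-⊎ : ∀ {R : Pred (Fin k) 0ℓ} (R? : Decidable R) → (∀ i → P i → Q i ⊎ R i) →
          # P? ℕ.≤ # Q? ℕ.+ # R?
    #-⊎ R? P⊆Q∪R = begin
      # P?
        ≡⟨ #≡sum ⟩
      sum (indicator ∘ P?)
        ≤⟨ sum-mono-≤ (λ i → indicator-⊎ (P? i) (Q? i) (R? i) (P⊆Q∪R i)) ⟩
      sum (λ i → indicator (Q? i) ℕ.+ indicator (R? i))
        ≡⟨ ∑-distrib-+ (indicator ∘ Q?) (indicator ∘ R?) ⟩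
      sum (indicator ∘ Q?) ℕ.+ sum (indicator ∘ R?)
        ≡⟨ cong₂ ℕ._+_ (count-tabulate Q? id) (count-tabulate R? id) ⟨
      # Q? ℕ.+ # R?
        ∎
      where open ℕₚ.≤-Reasoning

#-none : ∀ {k} {P : Pred (Fin k) 0ℓ} (P? : Decidable P) → (∀ i → ¬ P i) → # P? ≡ 0
#-none {zero}  P? ¬P = refl
#-none {suc k} P? ¬P = trans (#≡sum P?) (cong₂ ℕ._+_
  (ℕₚ.n≤0⇒n≡0 (indicator-mono (P? zero) (no id) (¬P zero)))
  (trans (sym (#≡sum (P? ∘ suc))) (#-none (P? ∘ suc) (¬P ∘ suc))))

#-subsingleton : ∀ {k} {P : Pred (Fin k) 0ℓ} (P? : Decidable P) →
                 (∀ {i j} → P i → P j → i ≡ j) → # P? ℕ.≤ 1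
#-subsingleton {zero}  P? unique = z≤n
#-subsingleton {suc k} P? unique = begin
  # P?
    ≡⟨ #≡sum P? ⟩
  indicator (P? zero) ℕ.+ sum (indicator ∘ P? ∘ suc)
    ≡⟨ cong (indicator (P? zero) ℕ.+_) (#≡sum (P? ∘ suc)) ⟨
  indicator (P? zero) ℕ.+ # (P? ∘ suc)
    ≤⟨ split (P? zero) ⟩
  1
    ∎
  where
  open ℕₚ.≤-Reasoning
  split : (z? : Dec _) → indicator z? ℕ.+ # (P? ∘ suc) ℕ.≤ 1
  split (yes z) = ℕₚ.≤-reflexive (cong suc (#-none (P? ∘ suc) (λ i p → case unique z p of λ ())))
  split (no _)  = #-subsingleton (P? ∘ suc) (λ p q → suc-injective (unique p q))

-- The pairs related by `R` are counted by rows and by columns. A row over `P` holds at least `lo`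
-- of them, a column at most `hi`, and a column outside `Q` none. All counting inequalities between
-- positions, sets and edges below are instances.
double-counting :
  ∀ {a b} {P : Pred (Fin a) 0ℓ} {Q : Pred (Fin b) 0ℓ} {R : Fin a → Fin b → Set}
  (P? : Decidable P) (Q? : Decidable Q) (R? : ∀ i j → Dec (R i j)) {lo hi : ℕ} →
  (∀ i → P i → lo ℕ.≤ # (R? i)) →
  (∀ j → # (λ i → R? i j) ℕ.≤ hi) →
  (∀ i j → R i j → Q j) →
  # P? ℕ.* lo ℕ.≤ # Q? ℕ.* hi
double-counting P? Q? R? {lo} {hi} lower upper R⇒Q = begin
  # P? ℕ.* lo                                ≡⟨ cong (ℕ._* lo) (#≡sum P?) ⟩
  sum (indicator ∘ P?) ℕ.* lo                ≡⟨ *-distribʳ-sum lo (indicator ∘ P?) ⟩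
  sum (λ i → indicator (P? i) ℕ.* lo)        ≤⟨ sum-mono-≤ row ⟩
  sum (λ i → sum (λ j → indicator (R? i j))) ≡⟨ ∑-comm (λ i j → indicator (R? i j)) ⟩
  sum (λ j → sum (λ i → indicator (R? i j))) ≤⟨ sum-mono-≤ column ⟩
  sum (λ j → indicator (Q? j) ℕ.* hi)        ≡⟨ *-distribʳ-sum hi (indicator ∘ Q?) ⟨
  sum (indicator ∘ Q?) ℕ.* hi                ≡⟨ cong (ℕ._* hi) (#≡sum Q?) ⟨
  # Q? ℕ.* hi                                ∎
  where
  open ℕₚ.≤-Reasoning
  row : ∀ i → indicator (P? i) ℕ.* lo ℕ.≤ sum (λ j → indicator (R? i j))
  row i with P? i
  ... | no _  = z≤n
  ... | yes p rewrite ℕₚ.*-identityˡ lo | sym (#≡sum (R? i)) = lower i p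
  column : ∀ j → sum (λ i → indicator (R? i j)) ℕ.≤ indicator (Q? j) ℕ.* hi
  column j with Q? j
  ... | yes _ rewrite ℕₚ.*-identityˡ hi | sym (#≡sum (λ i → R? i j)) = upper j
  ... | no ¬q = ℕₚ.≤-reflexive
    (trans (sym (#≡sum (λ i → R? i j))) (#-none (λ i → R? i j) (λ i r → ¬q (R⇒Q i j r))))

#-all : ∀ {k} {P : Pred (Fin k) 0ℓ} (P? : Decidable P) → (∀ i → P i) → # P? ≡ k
#-all {zero}  P? all = refl
#-all {suc k} P? all = trans (#≡sum P?) (cong₂ ℕ._+_
  (ℕₚ.≤-antisym (indicator-mono (P? zero) (yes (all zero)) id)
                (indicator-mono (yes (all zero)) (P? zero) id))
  (trans (sym (#≡sum (P? ∘ suc))) (#-all (P? ∘ suc) (all ∘ suc))))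

∣∣≡# : ∀ {n} (p : Subset n) → ∣ p ∣ ≡ # (_∈? p)
∣∣≡# []            = refl
∣∣≡# (inside  ∷ p) = trans (cong suc (trans (∣∣≡# p) (#≡sum (_∈? p))))
                           (sym (#≡sum (_∈? (inside ∷ p))))
∣∣≡# (outside ∷ p) = trans (trans (∣∣≡# p) (#≡sum (_∈? p)))
                           (sym (#≡sum (_∈? (outside ∷ p))))

-- Extrema and minimisation over finitely many words

minimum-lower : ∀ {k} (f : Fin k → ℕ) i → minimum f ℕ.≤ f i
minimum-lower {suc zero}    f zero    = ℕₚ.≤-refl
minimum-lower {suc (suc k)} f zero    = ℕₚ.m⊓n≤m _ _
minimum-lower {suc (suc k)} f (suc i) = ℕₚ.≤-trans (ℕₚ.m⊓n≤n _ _) (minimum-lower (f ∘ suc) i)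

maximum-upper : ∀ {k} (f : Fin k → ℕ) i → f i ℕ.≤ maximum f
maximum-upper f zero    = ℕₚ.m≤m⊔n _ _
maximum-upper f (suc i) = ℕₚ.≤-trans (maximum-upper (f ∘ suc) i) (ℕₚ.m≤n⊔m _ _)

-- Exhaustive search through the `q ^ n` words, enumerated by `finToFun`. Since words are functions,
-- a given `c′` is only pointwise equal to a listed word, so `P` and `cost` have to respect `≗`.
minimiser :
  ∀ {q n} {P : (Fin n → Fin q) → Set} (P? : ∀ c → Dec (P c)) →
  (∀ {c c′} → c ≗ c′ → P c → P c′) →
  (cost : (Fin n → Fin q) → ℕ) → (∀ {c c′} → c ≗ c′ → cost c ℕ.≤ cost c′) →
  ∃ P → ∃ λ c → P c × (∀ c′ → P c′ → cost c ℕ.≤ cost c′)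
minimiser {q} {n} {P} P? P-resp cost cost-resp (c₀ , p₀) =
    best
  -- `argmin` may return its default `c₀`, for which `p₀` vouches; every other candidate has passed
  -- the filter.
  , argmin-all cost {P = P} p₀ (all-filter P? words)
  , λ c′ p′ → ℕₚ.≤-trans
      (All.lookup (f[argmin]≤f[xs] {f = cost} c₀ candidates)
        (∈-filter⁺ P? (∈-map⁺ finToFun (∈-allFin (funToFin c′)))
          (P-resp (λ i → sym (finToFun-funToFin c′ i)) p′)))
      (cost-resp (finToFun-funToFin c′))
  where
  words candidates : List (Fin n → Fin q)
  words      = map finToFun (allFin (q ℕ.^ n))
  candidates = filter P? words
  best : Fin n → Fin q
  best = argmin cost c₀ candidates

-- Words

at-build : ∀ {A : Set} {n} (s : Subset n) (a : ∀ {i} → i ∈ s → A) {i} (p : i ∈ s) →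
           at (build s a) p ≡ a p
at-build (inside  ∷ s) a here      = refl
at-build (inside  ∷ s) a (there p) = at-build s (λ p → a (there p)) p
at-build (outside ∷ s) a (there p) = at-build s (λ p → a (there p)) p

Word-ext : ∀ {A : Set} {n} {s : Subset n} (v w : Word A s) →
           (∀ {i} (p : i ∈ s) → at v p ≡ at w p) → v ≡ w
Word-ext []       []       eq = refl
Word-ext (a ∷ v)  (b ∷ w)  eq = cong₂ _∷_ (eq here) (Word-ext v w (eq ∘ there))
Word-ext (skip v) (skip w) eq = cong skip (Word-ext v w (eq ∘ there))

at-irrelevant : ∀ {A : Set} {n} {s : Subset n} (w : Word A s) {i} (p p′ : i ∈ s) →
                at w p ≡ at w p′
at-irrelevant (a ∷ w)  here      here       = refl
at-irrelevant (a ∷ w)  (there p) (there p′) = at-irrelevant w p p′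
at-irrelevant (skip w) (there p) (there p′) = at-irrelevant w p p′

restrict-cong : ∀ {A : Set} {n} (s : Subset n) {g h : Fin n → A} → g ≗ h →
                restrict s g ≡ restrict s h
restrict-cong s g≗h = Word-ext _ _ λ {i} p →
  trans (at-build s _ p) (trans (g≗h i) (sym (at-build s _ p)))

shrink-restrict : ∀ {A : Set} {n} {s t : Subset n} (t⊆s : t ⊆ s) (g : Fin n → A) →
                  shrink t⊆s (restrict s g) ≡ restrict t g
shrink-restrict {s = s} {t} t⊆s g = Word-ext _ _ λ p →
  trans (at-build t _ p) (trans (at-build s _ (t⊆s p)) (sym (at-build t _ p)))

-- Lifted codes and their line codes

module _ {q n} (𝒞 : LiftedCode q n) where
  open LiftedCode 𝒞

  accepts? : ∀ s (g : Fin n → Fin q) → Dec (T (code s (restrict (set s) g)))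
  accepts? = Tester.accepts? naturalTester

  C? : ∀ c → Dec (C c)
  C? c = all? (λ s → accepts? s c)

  C-resp-≗ : ∀ {c c′} → c ≗ c′ → C c → C c′
  C-resp-≗ c≗c′ Cc s = subst (T ∘ code s) (restrict-cong (set s) c≗c′) (Cc s)

  -- Line words, gluing and nearest elements of the line code

  line : ∀ {c} → C c → ∀ s → Codeword s
  line {c} Cc s = restrict (set s) c , Cc s

  line∈L : ∀ {c} (Cc : C c) → L (line Cc)
  line∈L {c} Cc s s′ = trans (shrink-restrict (p∩q⊆p (set s) (set s′)) c)
                             (sym (shrink-restrict (p∩q⊆q (set s) (set s′)) c))

  glue : (∀ s → Codeword s) → Fin n → Fin q
  glue h i with covering i
  ... | s , i∈s = at (proj₁ (h s)) i∈s

  -- The set that `covering` picks for `i` meets `set s` in `i`, and the compatibility of `h` on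
  -- this intersection equates the two letters. Hence the arbitrary choices in `glue` are harmless
  -- on `L`, and every element of `L` is the line word of a word of `C`.
  restrict-glue : ∀ h → L h → ∀ s → restrict (set s) (glue h) ≡ proj₁ (h s)
  restrict-glue h Lh s = Word-ext _ _ λ {i} i∈s →
    let s′ , i∈s′ = covering i
        i∈both    = x∈p∩q⁺ (i∈s′ , i∈s)
        open ≡-Reasoning
    in begin
      at (restrict (set s) (glue h)) i∈s
        ≡⟨ at-build (set s) _ i∈s ⟩
      at (proj₁ (h s′)) i∈s′
        ≡⟨ at-irrelevant (proj₁ (h s′)) _ _ ⟩
      at (proj₁ (h s′)) (p∩q⊆p (set s′) (set s) i∈both)
        ≡⟨ at-build _ _ i∈both ⟨
      at (shrink (p∩q⊆p (set s′) (set s)) (proj₁ (h s′))) i∈both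
        ≡⟨ cong (λ w → at w i∈both) (Lh s′ s) ⟩
      at (shrink (p∩q⊆q (set s′) (set s)) (proj₁ (h s))) i∈both
        ≡⟨ at-build _ _ i∈both ⟩
      at (proj₁ (h s)) (p∩q⊆q (set s′) (set s) i∈both)
        ≡⟨ at-irrelevant (proj₁ (h s)) _ _ ⟩
      at (proj₁ (h s)) i∈s
        ∎

  glue∈C : ∀ h → L h → C (glue h)
  glue∈C h Lh s = subst (T ∘ code s) (sym (restrict-glue h Lh s)) (proj₂ (h s))

  codeword-≡ : ∀ {s} {v w : Codeword s} → proj₁ v ≡ proj₁ w → v ≡ w
  codeword-≡ {v = _ , t} {_ , t′} refl = cong (_ ,_) (T-irrelevant t t′)

  -- The Hamming distance from f to the line word of c, stated so as not to
  -- depend on a proof of c ∈ C.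
  distance : (∀ s → Codeword s) → (Fin n → Fin q) → ℕ
  distance f c = # λ s → ¬? (Word-≟ _≟ᶠ_ (proj₁ (f s)) (restrict (set s) c))

  distance-resp-≗ : ∀ f {c c′} → c ≗ c′ → distance f c ℕ.≤ distance f c′
  distance-resp-≗ f {c} {c′} c≗c′ = #-mono
    (λ s → ¬? (Word-≟ _≟ᶠ_ (proj₁ (f s)) (restrict (set s) c)))
    (λ s → ¬? (Word-≟ _≟ᶠ_ (proj₁ (f s)) (restrict (set s) c′)))
    (λ s f≢c f≡c′ → f≢c (trans f≡c′ (sym (restrict-cong (set s) c≗c′))))

  hamming-line : ∀ f {c} (Cc : C c) → distance f c ≡ Space.hamming lineAmbient f (line Cc)
  hamming-line f {c} Cc = ℕₚ.≤-antisym
    (#-mono words? codewords? (λ s f≢c f≡c → f≢c (cong proj₁ f≡c)))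
    (#-mono codewords? words? (λ s f≢c f≡c → f≢c (codeword-≡ f≡c)))
    where
    words?     = λ s → ¬? (Word-≟ _≟ᶠ_ (proj₁ (f s)) (restrict (set s) c))
    codewords? = λ s → ¬? (Space._≟_ lineAmbient (f s) (line Cc s))

  distance-glue : ∀ f {h} → L h → distance f (glue h) ℕ.≤ Space.hamming lineAmbient f h
  distance-glue f {h} Lh = #-mono
    (λ s → ¬? (Word-≟ _≟ᶠ_ (proj₁ (f s)) (restrict (set s) (glue h))))
    (λ s → ¬? (Space._≟_ lineAmbient (f s) (h s)))
    (λ s f≢h f≡h → f≢h (trans (cong proj₁ f≡h) (sym (restrict-glue h Lh s))))

  -- The soundness hypothesis speaks of the exact distance to `L`, so a minimiser has to be
  -- exhibited. The search runs over `C`, whose words can be enumerated; gluing shows that no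
  -- element of `L` is missed.
  nearest : ∀ f → ∃ λ c → ∃ λ (Cc : C c) → ∀ h → L h →
            Space.hamming lineAmbient f (line Cc) ℕ.≤ Space.hamming lineAmbient f h
  nearest f =
    let c , Cc , least = minimiser C? C-resp-≗ (distance f) (distance-resp-≗ f) C-nonempty
    in c , Cc , λ h Lh → begin
      Space.hamming lineAmbient f (line Cc)  ≡⟨ hamming-line f Cc ⟨
      distance f c                           ≤⟨ least (glue h) (glue∈C h Lh) ⟩
      distance f (glue h)                    ≤⟨ distance-glue f Lh ⟩
      Space.hamming lineAmbient f h          ∎
    where open ℕₚ.≤-Reasoning

  -- Decoding, and comparison of the distances in the two spaces

  decode : (Fin n → Fin q) → ∀ s → Codeword s
  decode g s with accepts? s g
  ... | yes acc = _ , acc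
  -- Any codeword will do: these coordinates are charged to the rejections of `g`.
  ... | no _    = code-nonempty s

  decode-accept : ∀ g s → T (code s (restrict (set s) g)) →
                  proj₁ (decode g s) ≡ restrict (set s) g
  decode-accept g s acc with accepts? s g
  ... | yes _  = refl
  ... | no rej = contradiction acc rej

  -- Double counting of the incidences `i ∈ set s`. It serves to pass from fractions of `S` to
  -- fractions of the positions.
  incidence-bound : m ℕ.* kMin ℕ.≤ n ℕ.* DMax
  incidence-bound = begin
    m ℕ.* kMin                     ≡⟨ cong (ℕ._* kMin) (#-all {k = m} U? _) ⟨
    # (U? {A = Fin m}) ℕ.* kMin    ≤⟨ double-counting U? U? (λ s i → i ∈? set s)
      (λ s _ → ℕₚ.≤-trans (minimum-lower (λ s → ∣ set s ∣) s) (ℕₚ.≤-reflexive (∣∣≡# (set s))))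
      (maximum-upper (λ i → # (λ s → i ∈? set s)))
      _ ⟩
    # (U? {A = Fin n}) ℕ.* DMax    ≡⟨ cong (ℕ._* DMax) (#-all {k = n} U? _) ⟩
    n ℕ.* DMax                     ∎
    where open ℕₚ.≤-Reasoning

  -- Let `i` be a position where `g` and `c` differ, and let `set s` contain it. If the natural
  -- tester accepts at `s`, then `decode g s` is the restriction of `g` and so differs from that of
  -- `c`. Thus at least `DMin` bad sets pass through `i`, and each bad set has at most `kMax`
  -- positions.
  hamming-bound : ∀ g {c} (Cc : C c) → Space.hamming ambient g c ℕ.* DMin ℕ.≤
    (Tester.rejections naturalTester g ℕ.+ Space.hamming lineAmbient (decode g) (line Cc)) ℕ.* kMax
  hamming-bound g {c} Cc = begin
    Space.hamming ambient g c ℕ.* DMin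
      ≤⟨ double-counting differ? bad? (λ i s → differ? i ×-dec (i ∈? set s))
           (λ i g≢c → ℕₚ.≤-trans (minimum-lower (λ i → # (λ s → i ∈? set s)) i)
             (#-mono (λ s → i ∈? set s) (λ s → differ? i ×-dec (i ∈? set s)) (λ _ → g≢c ,_)))
           (λ s → ℕₚ.≤-trans
             (#-mono (λ i → differ? i ×-dec (i ∈? set s)) (_∈? set s) (λ _ → proj₂))
             (ℕₚ.≤-trans (ℕₚ.≤-reflexive (sym (∣∣≡# (set s))))
                         (maximum-upper (λ s → ∣ set s ∣) s)))
           differ⇒bad ⟩
    # bad? ℕ.* kMax
      ≤⟨ ℕₚ.*-monoˡ-≤ kMax (#-⊎ bad? reject? moved? (λ _ → id)) ⟩
    (# reject? ℕ.+ # moved?) ℕ.* kMax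
      ∎
    where
    open ℕₚ.≤-Reasoning
    differ? = λ i → ¬? (g i ≟ᶠ c i)
    reject? = λ s → ¬? (accepts? s g)
    moved?  = λ s → ¬? (Space._≟_ lineAmbient (decode g s) (line Cc s))
    bad?    = λ s → reject? s ⊎-dec moved? s
    differ⇒bad : ∀ i s → g i ≢ c i × i ∈ set s →
                 ¬ T (code s (restrict (set s) g)) ⊎ decode g s ≢ line Cc s
    differ⇒bad i s (g≢c , i∈s) = cases (accepts? s g)
      where
      -- Not a `with`, which would also abstract the scrutinee inside `decode`.
      cases : Dec (T (code s (restrict (set s) g))) →
              ¬ T (code s (restrict (set s) g)) ⊎ decode g s ≢ line Cc s
      cases (no rej)  = inj₁ rej
      cases (yes acc) = inj₂ λ f≡c → g≢c
        (trans (sym (at-build (set s) _ i∈s))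
        (trans (cong (λ w → at w i∈s) (trans (sym (decode-accept g s acc)) (cong proj₁ f≡c)))
               (at-build (set s) _ i∈s)))

  -- Labelled graphs and the edge tester

  module _ {G : Graph} (ℓ : Labelling 𝒞 G) where
    open Graph G
    open Labelling ℓ

    ℓᵥ-injective : Injective _≡_ _≡_ ℓᵥ
    ℓᵥ-injective = proj₁ ℓᵥ-bijective

    vertex : Fin m → Fin nV
    vertex s = proj₁ (proj₂ ℓᵥ-bijective s)

    ℓᵥ-vertex : ∀ s → ℓᵥ (vertex s) ≡ s
    ℓᵥ-vertex s = proj₂ (proj₂ ℓᵥ-bijective s) refl

    vertex-injective : Injective _≡_ _≡_ vertex
    vertex-injective eq = trans (sym (ℓᵥ-vertex _)) (trans (cong ℓᵥ eq) (ℓᵥ-vertex _))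

    vertex-ℓᵥ : ∀ v → vertex (ℓᵥ v) ≡ v
    vertex-ℓᵥ v = ℓᵥ-injective (ℓᵥ-vertex (ℓᵥ v))

    incident? : ∀ v e → Dec (Incident v e)
    incident? v e = (src e ≟ᶠ v) ⊎-dec (tgt e ≟ᶠ v)

    -- Double counting of incidences between vertices and edges. Vertices are indexed by `Fin m`
    -- through `vertex`, whose injectivity lets each of the two ends of an edge count at most once.
    handshake : ∀ {dmin} → (∀ v → dmin ℕ.≤ degree v) → m ℕ.* dmin ℕ.≤ nE ℕ.* 2
    handshake {dmin} dmin≤ = begin
      m ℕ.* dmin                   ≡⟨ cong (ℕ._* dmin) (#-all {k = m} U? _) ⟨
      # (U? {A = Fin m}) ℕ.* dmin  ≤⟨ double-counting U? U? (incident? ∘ vertex)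
        (λ s _ → dmin≤ (vertex s)) two-ends _ ⟩
      # (U? {A = Fin nE}) ℕ.* 2    ≡⟨ cong (ℕ._* 2) (#-all {k = nE} U? _) ⟩
      nE ℕ.* 2                     ∎
      where
      open ℕₚ.≤-Reasoning
      single : ∀ v → # (λ s → v ≟ᶠ vertex s) ℕ.≤ 1
      single v = #-subsingleton (λ s → v ≟ᶠ vertex s)
        (λ v≡s v≡s′ → vertex-injective (trans (sym v≡s) v≡s′))
      two-ends : ∀ e → # (λ s → incident? (vertex s) e) ℕ.≤ 2
      two-ends e = ℕₚ.≤-trans
        (#-⊎ (λ s → incident? (vertex s) e) (λ s → src e ≟ᶠ vertex s) (λ s → tgt e ≟ᶠ vertex s)
             (λ _ → id))
        (ℕₚ.+-mono-≤ (single (src e)) (single (tgt e)))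

    -- Both views are the restriction of `g` itself to `ℓₑ e`.
    edge-accept : ∀ g e → T (code _ (restrict (set (ℓᵥ (src e))) g)) →
                  T (code _ (restrict (set (ℓᵥ (tgt e))) g)) →
                  srcView (decode g) e ≡ tgtView (decode g) e
    edge-accept g e acc acc′ = trans
      (view (ℓₑ⊆ℓᵥ (inj₁ refl)) acc) (sym (view (ℓₑ⊆ℓᵥ (inj₂ refl)) acc′))
      where
      view : ∀ {s} (e⊆s : ℓₑ e ⊆ set s) → T (code s (restrict (set s) g)) →
             shrink e⊆s (proj₁ (decode g s)) ≡ restrict (ℓₑ e) g
      view {s} e⊆s acc = trans (cong (shrink e⊆s) (decode-accept g s acc)) (shrink-restrict e⊆s g)

    -- Each rejecting edge is charged to an endpoint whose set is rejected for `g`, which exists by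
    -- `edge-accept`. A vertex is charged by at most `dmax` edges.
    edge-bound : ∀ {dmax} → (∀ v → degree v ℕ.≤ dmax) → ∀ g →
      Tester.rejections edgeTester (decode g) ℕ.≤ Tester.rejections naturalTester g ℕ.* dmax
    edge-bound {dmax} ≤dmax g = begin
      # edge-reject?        ≡⟨ ℕₚ.*-identityʳ _ ⟨
      # edge-reject? ℕ.* 1  ≤⟨ double-counting edge-reject? reject? cause?
        bad-end
        (λ s → ℕₚ.≤-trans
          (#-mono (λ e → cause? e s) (incident? (vertex s)) (λ _ → proj₂)) (≤dmax (vertex s)))
        (λ _ _ → proj₁) ⟩
      # reject? ℕ.* dmax    ∎
      where
      open ℕₚ.≤-Reasoning
      edge-reject? = λ e → ¬? (Tester.accepts? edgeTester e (decode g))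
      reject?      = λ s → ¬? (accepts? s g)
      cause?       = λ e s → reject? s ×-dec incident? (vertex s) e
      bad-end : ∀ e → srcView (decode g) e ≢ tgtView (decode g) e → 1 ℕ.≤ # (cause? e)
      bad-end e rej = cases (accepts? (ℓᵥ (src e)) g) (accepts? (ℓᵥ (tgt e)) g)
        where
        -- Not a `with`, which would also abstract the scrutinees inside `decode`.
        cases : Dec (T (code _ (restrict (set (ℓᵥ (src e))) g))) →
                Dec (T (code _ (restrict (set (ℓᵥ (tgt e))) g))) → 1 ℕ.≤ # (cause? e)
        cases (yes acc) (yes acc′) = contradiction (edge-accept g e acc acc′) rej
        cases (no bad)  _          = #-positive (cause? e) (bad , inj₁ (sym (vertex-ℓᵥ (src e))))
        cases (yes _)   (no bad)   = #-positive (cause? e) (bad , inj₂ (sym (vertex-ℓᵥ (tgt e))))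

-- Ordered fields

module OrderedFieldProperties {c ℓ₁ ℓ₂} (F : OrderedField c ℓ₁ ℓ₂) where
  open OrderedField F hiding (refl; sym; trans)
  open OrderedField F public using ()
    renaming (refl to ≈-refl; sym to ≈-sym; trans to ≈-trans)
  open Relation.Binary.Structures.IsTotalOrder isTotalOrder
    public using (total; antisym; isPartialOrder; ≤-respʳ-≈)
    renaming (trans to ≤-trans; refl to ≤-refl)
  open Algebra.Properties.Ring ring using (-‿distribˡ-*; -‿distribʳ-*)
  open Algebra.Properties.AbelianGroup +-abelianGroup using () renaming (⁻¹-involutive to -‿involutive)
  open Algebra.Properties.Monoid.Mult +-monoid using (×-homo-+)
  open Algebra.Properties.Semiring.Mult semiring using (×1-homo-*)
  open Algebra.Solver.Ring.NaturalCoefficients.Default commutativeSemiring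
    using (solve; _:=_; _:+_; _:*_)

  poset : Poset c ℓ₁ ℓ₂
  poset = record { isPartialOrder = isPartialOrder }

  open Relation.Binary.Reasoning.PartialOrder poset

  -- Monotonicity and signs

  +-monoʳ-≤ : ∀ z {x y} → x ≤ y → z + x ≤ z + y
  +-monoʳ-≤ z {x} {y} x≤y = begin
    z + x  ≈⟨ +-comm z x ⟩
    x + z  ≤⟨ +-monoˡ-≤ z x≤y ⟩
    y + z  ≈⟨ +-comm y z ⟩
    z + y  ∎

  +-nonNeg : ∀ {x y} → 0# ≤ x → 0# ≤ y → 0# ≤ x + y
  +-nonNeg {x} {y} 0≤x 0≤y = begin
    0#      ≤⟨ 0≤x ⟩
    x       ≈⟨ +-identityʳ x ⟨
    x + 0#  ≤⟨ +-monoʳ-≤ x 0≤y ⟩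
    x + y   ∎

  -- The order axiom for products concerns nonnegative factors, so it is applied to `y + - x` and
  -- `z`, and `x * z` is then added.
  *-monoʳ-≤ : ∀ {z x y} → 0# ≤ z → x ≤ y → x * z ≤ y * z
  *-monoʳ-≤ {z} {x} {y} 0≤z x≤y = begin
    x * z                          ≈⟨ +-identityˡ _ ⟨
    0# + x * z                     ≤⟨ +-monoˡ-≤ (x * z) (*-nonNeg 0≤y-x 0≤z) ⟩
    (y + - x) * z + x * z          ≈⟨ distribʳ z _ _ ⟨
    (y + - x + x) * z
      ≈⟨ *-congʳ (≈-trans (+-assoc y (- x) x) (≈-trans (+-congˡ (-‿inverseˡ x)) (+-identityʳ y))) ⟩
    y * z                          ∎
    where
    0≤y-x : 0# ≤ y + - x
    0≤y-x = begin
      0#       ≈⟨ -‿inverseʳ x ⟨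
      x + - x  ≤⟨ +-monoˡ-≤ (- x) x≤y ⟩
      y + - x  ∎

  *-monoˡ-≤ : ∀ {z x y} → 0# ≤ z → x ≤ y → z * x ≤ z * y
  *-monoˡ-≤ {z} {x} {y} 0≤z x≤y = begin
    z * x  ≈⟨ *-comm z x ⟩
    x * z  ≤⟨ *-monoʳ-≤ 0≤z x≤y ⟩
    y * z  ≈⟨ *-comm y z ⟩
    z * y  ∎

  -- If `1# ≤ 0#`, then `- 1#` is nonnegative, and so is its square `1#`.
  0≤1 : 0# ≤ 1#
  0≤1 with total 0# 1#
  ... | inj₁ p = p
  ... | inj₂ 1≤0 = begin
    0#             ≤⟨ *-nonNeg 0≤-1 0≤-1 ⟩
    - 1# * - 1#    ≈⟨ -‿distribˡ-* 1# (- 1#) ⟨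
    - (1# * - 1#)  ≈⟨ -‿cong (*-identityˡ _) ⟩
    - (- 1#)       ≈⟨ -‿involutive 1# ⟩
    1#             ∎
    where
    0≤-1 : 0# ≤ - 1#
    0≤-1 = begin
      0#         ≈⟨ -‿inverseʳ 1# ⟨
      1# + - 1#  ≤⟨ +-monoˡ-≤ (- 1#) 1≤0 ⟩
      0# + - 1#  ≈⟨ +-identityˡ _ ⟩
      - 1#       ∎

  -- Strict positivity, in the form that gives access to the inverse axiom.
  Positive : Carrier → Set _
  Positive x = 0# ≤ x × ¬ (x ≈ 0#)

  *-inverseˡ : ∀ x → ¬ (x ≈ 0#) → x ⁻¹ * x ≈ 1#
  *-inverseˡ x x≉0 = ≈-trans (*-comm _ _) (*-inverseʳ x x≉0)

  x/y*y≈x : ∀ x {y} → Positive y → (x / y) * y ≈ x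
  x/y*y≈x x {y} (_ , y≉0) =
    ≈-trans (*-assoc _ _ _) (≈-trans (*-congˡ (*-inverseˡ y y≉0)) (*-identityʳ x))

  x*y/y≈x : ∀ x {y} → Positive y → x * y * y ⁻¹ ≈ x
  x*y/y≈x x {y} (_ , y≉0) =
    ≈-trans (*-assoc _ _ _) (≈-trans (*-congˡ (*-inverseʳ y y≉0)) (*-identityʳ x))

  *-positive : ∀ {x y} → Positive x → Positive y → Positive (x * y)
  *-positive {x} {y} (0≤x , x≉0) y>0@(0≤y , _) = *-nonNeg 0≤x 0≤y , λ xy≈0 →
    x≉0 (≈-trans (≈-sym (x*y/y≈x x y>0)) (≈-trans (*-congʳ xy≈0) (zeroˡ _)))

  +-positiveʳ : ∀ {x y} → 0# ≤ x → Positive y → Positive (x + y)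
  +-positiveʳ {x} {y} 0≤x (0≤y , y≉0) = +-nonNeg 0≤x 0≤y , λ x+y≈0 →
    y≉0 (antisym (begin
      y       ≈⟨ +-identityˡ y ⟨
      0# + y  ≤⟨ +-monoˡ-≤ y 0≤x ⟩
      x + y   ≈⟨ x+y≈0 ⟩
      0#      ∎) 0≤y)

  ⁻¹-nonNeg : ∀ {x} → Positive x → 0# ≤ x ⁻¹
  ⁻¹-nonNeg {x} (0≤x , x≉0) with total 0# (x ⁻¹)
  ... | inj₁ p = p
  ... | inj₂ x⁻¹≤0 = contradiction (antisym 0≤1 (begin
    1#        ≈⟨ *-inverseʳ x x≉0 ⟨
    x * x ⁻¹  ≤⟨ *-monoˡ-≤ 0≤x x⁻¹≤0 ⟩
    x * 0#    ≈⟨ zeroʳ x ⟩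
    0#        ∎)) 0#≉1#

  ⁻¹-positive : ∀ {x} → Positive x → Positive (x ⁻¹)
  ⁻¹-positive {x} x>0@(_ , x≉0) = ⁻¹-nonNeg x>0 , λ x⁻¹≈0 →
    0#≉1# (≈-trans (≈-sym (zeroʳ x)) (≈-trans (*-congˡ (≈-sym x⁻¹≈0)) (*-inverseʳ x x≉0)))

  *-cancelʳ-≤ : ∀ {z x y} → Positive z → x * z ≤ y * z → x ≤ y
  *-cancelʳ-≤ {z} {x} {y} z>0 xz≤yz = begin
    x              ≈⟨ x*y/y≈x x z>0 ⟨
    x * z * z ⁻¹   ≤⟨ *-monoʳ-≤ (⁻¹-nonNeg z>0) xz≤yz ⟩
    y * z * z ⁻¹   ≈⟨ x*y/y≈x y z>0 ⟩
    y              ∎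

  -- Natural numbers in the field

  fromℕ-nonNeg : ∀ k → 0# ≤ fromℕ k
  fromℕ-nonNeg zero    = ≤-refl
  fromℕ-nonNeg (suc k) = +-nonNeg 0≤1 (fromℕ-nonNeg k)

  fromℕ-mono : ∀ {j k} → j ℕ.≤ k → fromℕ j ≤ fromℕ k
  fromℕ-mono {k = k} z≤n = fromℕ-nonNeg k
  fromℕ-mono (s≤s j≤k)   = +-monoʳ-≤ 1# (fromℕ-mono j≤k)

  fromℕ-positive : ∀ {k} → 1 ℕ.≤ k → Positive (fromℕ k)
  fromℕ-positive {suc k} _ =
    fromℕ-nonNeg (suc k) , λ 1+k≈0 →
      proj₂ (+-positiveʳ (fromℕ-nonNeg k) (0≤1 , 0#≉1# ∘ ≈-sym)) (≈-trans (+-comm _ _) 1+k≈0)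

  fromℕ-homo-+ : ∀ j k → fromℕ (j ℕ.+ k) ≈ fromℕ j + fromℕ k
  fromℕ-homo-+ = ×-homo-+ 1#

  fromℕ-homo-* : ∀ j k → fromℕ (j ℕ.* k) ≈ fromℕ j * fromℕ k
  fromℕ-homo-* = ×1-homo-*

  fromℕ-*-mono : ∀ i j k l → i ℕ.* j ℕ.≤ k ℕ.* l → fromℕ i * fromℕ j ≤ fromℕ k * fromℕ l
  fromℕ-*-mono i j k l ij≤kl = begin
    fromℕ i * fromℕ j  ≈⟨ fromℕ-homo-* i j ⟨
    fromℕ (i ℕ.* j)    ≤⟨ fromℕ-mono ij≤kl ⟩
    fromℕ (k ℕ.* l)    ≈⟨ fromℕ-homo-* k l ⟩
    fromℕ k * fromℕ l  ∎

  -- Here `Z` of `N` edges and `X` of `M` sets are rejected, and `D`, `d` bound the degrees.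
  -- Multiplying by `N * (M * d)` clears the denominators. `K` stands for `2 D / d` and enters
  -- through `K * d`, which keeps inverses away from the solver.
  ratio-bound : ∀ {Z X D d M N K} → Positive d → Positive M → Positive N → 0# ≤ D → 0# ≤ X →
    K * d ≈ fromℕ 2 * D → Z ≤ X * D → M * d ≤ N * fromℕ 2 → Z / N ≤ K * (X / M)
  ratio-bound {Z} {X} {D} {d} {M} {N} {K} d>0 M>0 N>0 0≤D 0≤X Kd≈2D Z≤XD Md≤2N =
    *-cancelʳ-≤ (*-positive N>0 (*-positive M>0 d>0)) (begin
      Z / N * (N * (M * d))      ≈⟨ *-assoc _ _ _ ⟨
      Z / N * N * (M * d)        ≈⟨ *-congʳ (x/y*y≈x Z N>0) ⟩
      Z * (M * d)                ≤⟨ *-monoʳ-≤ (proj₁ (*-positive M>0 d>0)) Z≤XD ⟩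
      X * D * (M * d)            ≤⟨ *-monoˡ-≤ (*-nonNeg 0≤X 0≤D) Md≤2N ⟩
      X * D * (N * fromℕ 2)
        ≈⟨ solve 4 (λ x d n t → x :* d :* (n :* t) := t :* d :* x :* n) ≈-refl X D N (fromℕ 2) ⟩
      fromℕ 2 * D * X * N        ≈⟨ *-congʳ (*-cong Kd≈2D (x/y*y≈x X M>0)) ⟨
      K * d * (X / M * M) * N
        ≈⟨ solve 5 (λ k d α m n → k :* d :* (α :* m) :* n := k :* α :* (n :* (m :* d)))
           ≈-refl K d (X / M) M N ⟩
      K * (X / M) * (N * (M * d)) ∎)

  -- The product of the two counting inequalities, divided by `N * M`. `H` is the Hamming distance
  -- on `N` positions and `W` bounds the number of bad sets among `M`.
  density-bound : ∀ {H Dₗ Dᵤ kₗ kᵤ W M N} → Positive M → Positive N → 0# ≤ kₗ → 0# ≤ W → 0# ≤ kᵤ →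
    H * Dₗ ≤ W * kᵤ → M * kₗ ≤ N * Dᵤ → kₗ * Dₗ * (H / N) ≤ kᵤ * Dᵤ * (W / M)
  density-bound {H} {Dₗ} {Dᵤ} {kₗ} {kᵤ} {W} {M} {N} M>0 N>0 0≤kₗ 0≤W 0≤kᵤ HD≤Wk Mk≤ND =
    *-cancelʳ-≤ (*-positive N>0 M>0) (begin
      kₗ * Dₗ * (H / N) * (N * M)
        ≈⟨ solve 5 (λ k d h n m → k :* d :* h :* (n :* m) := h :* n :* d :* (m :* k))
           ≈-refl kₗ Dₗ (H / N) N M ⟩
      H / N * N * Dₗ * (M * kₗ)       ≈⟨ *-congʳ (*-congʳ (x/y*y≈x H N>0)) ⟩
      H * Dₗ * (M * kₗ)               ≤⟨ *-monoʳ-≤ (*-nonNeg (proj₁ M>0) 0≤kₗ) HD≤Wk ⟩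
      W * kᵤ * (M * kₗ)               ≤⟨ *-monoˡ-≤ (*-nonNeg 0≤W 0≤kᵤ) Mk≤ND ⟩
      W * kᵤ * (N * Dᵤ)               ≈⟨ *-congʳ (*-congʳ (x/y*y≈x W M>0)) ⟨
      W / M * M * kᵤ * (N * Dᵤ)
        ≈⟨ solve 5 (λ k d w n m → w :* m :* k :* (n :* d) := k :* d :* w :* (n :* m))
           ≈-refl kᵤ Dᵤ (W / M) N M ⟩
      kᵤ * Dᵤ * (W / M) * (N * M)     ∎)

  -- After clearing `b` and `μ + K`, the chain is `a μ d ≤ μ (a η) ≤ b (μ α + μ δ) ≤ b (μ + K)
  -- α`. It multiplies by `μ` and never divides by it, so `μ ≈ 0#` is covered.
  soundness-bound : ∀ {a b μ K α δ η d} → 0# ≤ a → Positive b → 0# ≤ μ → Positive (μ + K) →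
    μ * δ ≤ K * α → a * η ≤ b * (α + δ) → d ≤ η →
    a / b * (μ / (μ + K)) * d ≤ α
  soundness-bound {a} {b} {μ} {K} {α} {δ} {η} {d} 0≤a b>0 0≤μ ρ>0 μδ≤Kα aη≤ d≤η =
    *-cancelʳ-≤ (*-positive b>0 ρ>0) (begin
      a / b * (μ / ρ) * d * (b * ρ)
        ≈⟨ solve 5 (λ a′ μ′ d b ρ → a′ :* μ′ :* d :* (b :* ρ) := a′ :* b :* (μ′ :* ρ) :* d)
           ≈-refl (a / b) (μ / ρ) d b ρ ⟩
      a / b * b * (μ / ρ * ρ) * d      ≈⟨ *-congʳ (*-cong (x/y*y≈x a b>0) (x/y*y≈x μ ρ>0)) ⟩
      a * μ * d                        ≤⟨ *-monoˡ-≤ (*-nonNeg 0≤a 0≤μ) d≤η ⟩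
      a * μ * η
        ≈⟨ solve 3 (λ a μ η → a :* μ :* η := μ :* (a :* η)) ≈-refl a μ η ⟩
      μ * (a * η)                      ≤⟨ *-monoˡ-≤ 0≤μ aη≤ ⟩
      μ * (b * (α + δ))
        ≈⟨ solve 4 (λ μ b α δ → μ :* (b :* (α :+ δ)) := b :* (μ :* α :+ μ :* δ)) ≈-refl μ b α δ ⟩
      b * (μ * α + μ * δ)              ≤⟨ *-monoˡ-≤ (proj₁ b>0) (+-monoʳ-≤ (μ * α) μδ≤Kα) ⟩
      b * (μ * α + K * α)
        ≈⟨ solve 4 (λ μ b α k → b :* (μ :* α :+ k :* α) := α :* (b :* (μ :+ k))) ≈-refl μ b α K ⟩
      α * (b * ρ)                      ∎)
    where
    ρ : Carrier
    ρ = μ + K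

-- Soundness

module _ {c ℓ₁ ℓ₂} (F : OrderedField c ℓ₁ ℓ₂) {q n} (𝒞 : LiftedCode q n)
         {G : Graph} (ℓ : Labelling 𝒞 G) {dmin dmax : ℕ} where
  open OrderedField F hiding (refl; sym; trans)
  open OrderedFieldProperties F
  open LiftedCode 𝒞
  open Graph G
  open Labelling ℓ

  -- An element of `S` makes all denominators positive: `m`, `n`, `nE`, `kMax`, `DMax` and `μ + K`.
  soundness-nonempty :
    Fin m → 1 ℕ.≤ dmin → (∀ v → (dmin ℕ.≤ degree v) × (degree v ℕ.≤ dmax)) →
    ∀ {μ} → 0# ≤ μ → HasSoundness F lineAmbient L edgeTester μ →
    HasSoundness F ambient C naturalTester
      ( (fromℕ kMin * fromℕ DMin) / (fromℕ kMax * fromℕ DMax)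
      * (μ / (μ + fromℕ 2 * fromℕ dmax * fromℕ dmin ⁻¹)) )
  soundness-nonempty s 1≤dmin degrees {μ} 0≤μ sound g d (_ , d≤) = soundness-bound
    (*-nonNeg (fromℕ-nonNeg kMin) (fromℕ-nonNeg DMin))
    (*-positive (fromℕ-positive 1≤kMax) (fromℕ-positive 1≤DMax))
    0≤μ
    -- Positivity comes from the summand `2 dmax / dmin`.
    (+-positiveʳ 0≤μ (*-positive (*-positive 2>0 (fromℕ-positive 1≤dmax)) (⁻¹-positive dmin>0)))
    (≤-trans line-distance edge-ratio)
    word-distance
    (d≤ h₀ h₀∈C)
    where
    f = decode 𝒞 g
    h₀ = proj₁ (nearest 𝒞 f)
    h₀∈C : C h₀
    h₀∈C = proj₁ (proj₂ (nearest 𝒞 f))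
    X = Tester.rejections naturalTester g
    Y = Space.hamming lineAmbient f (line 𝒞 h₀∈C)
    Z = Tester.rejections edgeTester f
    H = Space.hamming ambient g h₀
    i = proj₁ (set-nonempty s)
    i∈s : i ∈ set s
    i∈s = proj₂ (set-nonempty s)
    inhabited : ∀ {k} → Fin k → 1 ℕ.≤ k
    inhabited {suc _} _ = s≤s z≤n
    shake : m ℕ.* dmin ℕ.≤ nE ℕ.* 2
    shake = handshake 𝒞 ℓ (proj₁ ∘ degrees)
    1≤kMax : 1 ℕ.≤ kMax
    1≤kMax = ℕₚ.≤-trans (#-positive (_∈? set s) i∈s)
      (ℕₚ.≤-trans (ℕₚ.≤-reflexive (sym (∣∣≡# (set s)))) (maximum-upper (λ s → ∣ set s ∣) s))
    1≤DMax : 1 ℕ.≤ DMax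
    1≤DMax = ℕₚ.≤-trans (#-positive (λ s → i ∈? set s) i∈s)
      (maximum-upper (λ i → # (λ s → i ∈? set s)) i)
    1≤dmax : 1 ℕ.≤ dmax
    1≤dmax = let v = vertex 𝒞 ℓ s in
      ℕₚ.≤-trans 1≤dmin (ℕₚ.≤-trans (proj₁ (degrees v)) (proj₂ (degrees v)))
    1≤nE : 1 ℕ.≤ nE
    -- Without edges the handshake inequality would read `m * dmin ≤ 0`.
    1≤nE = ℕₚ.n≢0⇒n>0 λ nE≡0 → ℕₚ.<⇒≱ (ℕₚ.*-mono-≤ (inhabited s) 1≤dmin)
      (subst (λ k → m ℕ.* dmin ℕ.≤ k ℕ.* 2) nE≡0 shake)
    2>0    = fromℕ-positive {2} (s≤s z≤n)
    dmin>0 = fromℕ-positive 1≤dmin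
    m>0    = fromℕ-positive (inhabited s)
    n>0    = fromℕ-positive (inhabited i)
    nE>0   = fromℕ-positive 1≤nE
    line-distance : μ * (fromℕ Y / fromℕ m) ≤ fromℕ Z / fromℕ nE
    -- By `nearest`, `Y / m` is the exact distance from `f` to `L`.
    line-distance = sound f (fromℕ Y / fromℕ m)
      ( (line 𝒞 h₀∈C , line∈L 𝒞 h₀∈C , ≈-refl)
      , λ h Lh → *-monoʳ-≤ (⁻¹-nonNeg m>0) (fromℕ-mono (proj₂ (proj₂ (nearest 𝒞 f)) h Lh)))
    edge-ratio : fromℕ Z / fromℕ nE ≤
                 fromℕ 2 * fromℕ dmax * fromℕ dmin ⁻¹ * (fromℕ X / fromℕ m)
    edge-ratio = ratio-bound dmin>0 m>0 nE>0 (fromℕ-nonNeg dmax) (fromℕ-nonNeg X)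
      (x/y*y≈x (fromℕ 2 * fromℕ dmax) dmin>0)
      (≤-respʳ-≈ (fromℕ-homo-* X dmax) (fromℕ-mono (edge-bound 𝒞 ℓ (proj₂ ∘ degrees) g)))
      (fromℕ-*-mono m dmin nE 2 shake)
    word-distance : fromℕ kMin * fromℕ DMin * (fromℕ H / fromℕ n) ≤
                    fromℕ kMax * fromℕ DMax * (fromℕ X / fromℕ m + fromℕ Y / fromℕ m)
    word-distance = ≤-respʳ-≈ (*-congˡ (distribʳ (fromℕ m ⁻¹) (fromℕ X) (fromℕ Y)))
      (density-bound m>0 n>0 (fromℕ-nonNeg kMin)
        (+-nonNeg (fromℕ-nonNeg X) (fromℕ-nonNeg Y)) (fromℕ-nonNeg kMax)
        (≤-respʳ-≈ (*-congʳ (fromℕ-homo-+ X Y))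
          (fromℕ-*-mono H DMin (X ℕ.+ Y) kMax (hamming-bound 𝒞 g h₀∈C)))
        (fromℕ-*-mono m kMin n DMax (incidence-bound 𝒞)))

-- With `k` a variable, the equation can be matched against `refl`; for the record projection `m` it
-- cannot.
minimum-empty : ∀ {k} → k ≡ 0 → (f : Fin k → ℕ) → minimum f ≡ 0
minimum-empty refl f = refl

theorem3p10 : ∀ {c ℓ₁ ℓ₂} (F : OrderedField c ℓ₁ ℓ₂) →
    let open OrderedField F in
    ∀ {q n : ℕ} (𝒞 : LiftedCode q n) →
    let open LiftedCode 𝒞 in
    EqualCardinalities →
    ∀ (G : Graph) (ℓ : Labelling 𝒞 G) (dmin dmax : ℕ) →
    1 ℕ.≤ dmin →
    (∀ v → (dmin ℕ.≤ Graph.degree G v) × (Graph.degree G v ℕ.≤ dmax)) →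
    ∀ (μ : Carrier) → 0# ≤ μ →
    HasSoundness F lineAmbient L (Labelling.edgeTester ℓ) μ →
    HasSoundness F ambient C naturalTester
    ( (fromℕ kMin * fromℕ DMin) / (fromℕ kMax * fromℕ DMax)
    * (μ / (μ + fromℕ 2 * fromℕ dmax * fromℕ dmin ⁻¹)) )
-- If S is empty, the claimed soundness involves inverses of 0#, whose values
-- are unknown; it vanishes because kMin = 0.
theorem3p10 F 𝒞 _ G ℓ dmin dmax 1≤dmin degrees μ 0≤μ sound g d d-dist
  with LiftedCode.m 𝒞 ℕₚ.≟ 0
... | no m≢0  = soundness-nonempty F 𝒞 ℓ (fromℕ< (ℕₚ.n≢0⇒n>0 m≢0))
                  1≤dmin degrees 0≤μ sound g d d-dist
... | yes m≡0 = begin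
  (fromℕ kMin * fromℕ DMin) / (fromℕ kMax * fromℕ DMax) * (μ / _) * d
    ≡⟨ cong (λ k → (fromℕ k * fromℕ DMin) / (fromℕ kMax * fromℕ DMax) * (μ / _) * d)
            (minimum-empty m≡0 (λ s → ∣ set s ∣)) ⟩
  (0# * fromℕ DMin) / (fromℕ kMax * fromℕ DMax) * (μ / _) * d
    ≈⟨ *-congʳ (*-congʳ (*-congʳ (zeroˡ _))) ⟩
  0# / (fromℕ kMax * fromℕ DMax) * (μ / _) * d
    ≈⟨ *-congʳ (*-congʳ (zeroˡ _)) ⟩
  0# * (μ / _) * d
    ≈⟨ *-congʳ (zeroˡ _) ⟩
  0# * d
    ≈⟨ zeroˡ d ⟩
  0#
    -- The rejection probability is `0#` times an inverse, hence `0#` whatever the value of that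
    -- inverse.
    ≈⟨ zeroˡ (fromℕ m ⁻¹) ⟨
  fromℕ 0 / fromℕ m
    ≡⟨ cong (λ k → fromℕ k / fromℕ m) no-rejections ⟨
  rejectProb F naturalTester g
    ∎
  where
  open OrderedField F hiding (refl; sym; trans)
  open OrderedFieldProperties F
  open LiftedCode 𝒞
  open Relation.Binary.Reasoning.PartialOrder poset
  no-rejections : Tester.rejections naturalTester g ≡ 0
  no-rejections = ℕₚ.n≤0⇒n≡0 (subst (Tester.rejections naturalTester g ℕ.≤_) m≡0
    (count≤n (λ s → ¬? (accepts? 𝒞 s g)) (tabulate id)))
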